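{- For any real $\alpha$ with $0<\alpha<4$, no strictly monotone deterministic online algorithm for maximizing a non-negative monotone submodular function under a partition matroid constraint with free disposal, on instances of the form described in the context (all parts of capacity $1$), can have competitive ratio strictly larger than $\frac1\alpha$.
   Context: Instances: let $\mathcal{U}$ be a universe of items with weights $\nu:\mathcal{U}\to\mathbb{R}_+$, and $\nu(X):=\sum_{x\in X}\nu(x)$ for $X\subseteq\mathcal{U}$. For $i\ge0$ let $\Omega_i:=\{(u,i):u\in\mathcal{U}\}$ and let $\Omega:=\bigcup_{i\ge0}\Omega_i$. A (finite) set $S\subset\Omega$ is independent iff $|S\cap\Omega_i|\le1$ for all $i$ (a partition matroid with unit capacities). The objective is $f(S):=\nu(\{x:(x,i)\in S\text{ for some }i\})$, which is monotone submodular. Online problem with free disposal: distinct elements of $\Omega$ arrive one by one in a finite sequence whose length is unknown to the algorithm. The algorithm maintains an independent set $S$, initially empty. When $u$ arrives, it may remove elements from $S$ and may include $u$ in $S$, as long as $S$ remains independent; rejected or removed elements cannot be retrieved. The algorithm has a value oracle for $f$ and an independence oracle, only on sets of elements that have arrived so far, so the decisions of a deterministic algorithm are determined by this information. $\mathsf{OPT}$ is an independent set of elements of the sequence maximizing $f$. A deterministic algorithm has competitive ratio $r$ if for every instance and at the end of every finite sequence, $f(S)\ge r\cdot f(\mathsf{OPT})$. Strict monotonicity: an algorithm is strictly monotone if, in each round, it includes the new arriving element into $S$ (possibly removing some elements from $S$) only if the objective value $f(S)$ strictly increases compared to its value at the beginning of the round. -}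

module Defs where

open import Data.Bool.Base using (Bool)
open import Data.Fin.Subset using (Subset; inside; outside) renaming (_⊆_ to _⊆ˢ_)
open import Data.List.Base using (List; []; _∷_; map; filter; deduplicate; foldr; length)
open import Data.List.Membership.Propositional using () renaming (_∈_ to _∈ˡ_)
import Data.List.Membership.DecPropositional as DecMembership
open import Data.List.Membership.Propositional.Properties using (∈-map⁺)
open import Data.List.Properties using (filter-none)
open import Data.List.Relation.Binary.Subset.Propositional using () renaming (_⊆_ to _⊆ˡ_)
open import Data.List.Relation.Unary.All using (All; all?) renaming (lookup to All-lookup)
import Data.List.Relation.Unary.All as All
open import Data.List.Relation.Unary.Unique.Propositional using (Unique)
open import Data.Nat.Base using (ℕ; suc; z≤n) renaming (_≤_ to _≤ℕ_; _⊔_ to _⊔ℕ_)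
import Data.Nat.Properties as ℕ
open import Data.Product.Base using (∃; _×_; _,_; proj₁; proj₂)
open import Data.Product.Properties using (≡-dec)
open import Data.Rational.Base as ℚ using (ℚ; 0ℚ; 1ℚ; ½; Positive; NonNegative; NonZero)
import Data.Rational.Properties as ℚ
open import Data.Rational.Solver using (module +-*-Solver)
open import Data.Vec.Base using ([]; _∷_; head)
open import Relation.Binary.Definitions using (DecidableEquality)
open import Relation.Binary.PropositionalEquality
open import Relation.Nullary using (¬_; Dec; yes; no; does)
open import Relation.Nullary.Decidable using (map′)

------------------------------------------------------------------------
-- Real numbers: Cauchy sequences of rationals, up to _≈_.  The Cauchy proofs of
-- the operations are abstract to keep normal forms small.

IsCauchy : (ℕ → ℚ) → Set
IsCauchy x = ∀ ε → 0ℚ ℚ.< ε →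
  ∃ λ N → ∀ m n → N ≤ℕ m → N ≤ℕ n → ℚ.∣ x m ℚ.- x n ∣ ℚ.< ε

record ℝ : Set where
  constructor mkℝ
  field
    seq    : ℕ → ℚ
    cauchy : IsCauchy seq
open ℝ public

infix 4 _≈_ _<_ _≤_
infixl 6 _+_
infixl 7 _*_

_≈_ : ℝ → ℝ → Set
x ≈ y = ∀ ε → 0ℚ ℚ.< ε → ∃ λ N → ∀ n → N ≤ℕ n → ℚ.∣ seq x n ℚ.- seq y n ∣ ℚ.< ε

_<_ : ℝ → ℝ → Set
x < y = ∃ λ δ → 0ℚ ℚ.< δ × ∃ λ N → ∀ n → N ≤ℕ n → seq x n ℚ.+ δ ℚ.≤ seq y n

_≤_ : ℝ → ℝ → Set
x ≤ y = ¬ (y < x)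

private
  abstract

    half-pos : ∀ {ε} → 0ℚ ℚ.< ε → 0ℚ ℚ.< ½ ℚ.* ε
    half-pos {ε} 0<ε = subst (ℚ._< ½ ℚ.* ε) (ℚ.*-zeroʳ ½) (ℚ.*-monoʳ-<-pos ½ 0<ε)

    half+half : ∀ ε → ½ ℚ.* ε ℚ.+ ½ ℚ.* ε ≡ ε
    half+half ε = trans (sym (ℚ.*-distribʳ-+ ε ½ ½)) (ℚ.*-identityˡ ε)

    bounded : (x : ℝ) → ∃ λ B → 0ℚ ℚ.< B × ∃ λ N → ∀ n → N ≤ℕ n → ℚ.∣ seq x n ∣ ℚ.< B
    bounded (mkℝ x c) with c 1ℚ (ℚ.positive⁻¹ 1ℚ)
    ... | N , close = ℚ.∣ x N ∣ ℚ.+ 1ℚ , 0<B , N , λ n N≤n → begin-strict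
        ℚ.∣ x n ∣                        ≡⟨ cong ℚ.∣_∣ (rearrange (x n) (x N)) ⟩
        ℚ.∣ x N ℚ.+ (x n ℚ.- x N) ∣      ≤⟨ ℚ.∣p+q∣≤∣p∣+∣q∣ (x N) (x n ℚ.- x N) ⟩
        ℚ.∣ x N ∣ ℚ.+ ℚ.∣ x n ℚ.- x N ∣  <⟨ ℚ.+-monoʳ-< ℚ.∣ x N ∣ (close n N N≤n ℕ.≤-refl) ⟩
        ℚ.∣ x N ∣ ℚ.+ 1ℚ                 ∎
      where
      open ℚ.≤-Reasoning
      open +-*-Solver
      rearrange : ∀ p q → p ≡ q ℚ.+ (p ℚ.- q)
      rearrange = solve 2 (λ p q → p := q :+ (p :- q)) refl
      0<B : 0ℚ ℚ.< ℚ.∣ x N ∣ ℚ.+ 1ℚ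
      0<B = ℚ.+-mono-≤-< (ℚ.0≤∣p∣ (x N)) (ℚ.positive⁻¹ 1ℚ)

    +-cauchy : (x y : ℝ) → IsCauchy (λ n → seq x n ℚ.+ seq y n)
    +-cauchy (mkℝ x cx) (mkℝ y cy) ε 0<ε
      with cx (½ ℚ.* ε) (half-pos 0<ε) | cy (½ ℚ.* ε) (half-pos 0<ε)
    ... | N₁ , c₁ | N₂ , c₂ = N₁ ⊔ℕ N₂ , λ m n N≤m N≤n → begin-strict
        ℚ.∣ (x m ℚ.+ y m) ℚ.- (x n ℚ.+ y n) ∣          ≡⟨ cong ℚ.∣_∣ (rearrange (x m) (y m) (x n) (y n)) ⟩
        ℚ.∣ (x m ℚ.- x n) ℚ.+ (y m ℚ.- y n) ∣          ≤⟨ ℚ.∣p+q∣≤∣p∣+∣q∣ (x m ℚ.- x n) (y m ℚ.- y n) ⟩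
        ℚ.∣ x m ℚ.- x n ∣ ℚ.+ ℚ.∣ y m ℚ.- y n ∣
          <⟨ ℚ.+-mono-< (c₁ m n (ℕ.m⊔n≤o⇒m≤o N₁ N₂ N≤m) (ℕ.m⊔n≤o⇒m≤o N₁ N₂ N≤n))
                        (c₂ m n (ℕ.m⊔n≤o⇒n≤o N₁ N₂ N≤m) (ℕ.m⊔n≤o⇒n≤o N₁ N₂ N≤n)) ⟩
        ½ ℚ.* ε ℚ.+ ½ ℚ.* ε                            ≡⟨ half+half ε ⟩
        ε                                              ∎
      where
      open ℚ.≤-Reasoning
      open +-*-Solver
      rearrange : ∀ a b c d → (a ℚ.+ b) ℚ.- (c ℚ.+ d) ≡ (a ℚ.- c) ℚ.+ (b ℚ.- d)
      rearrange = solve 4 (λ a b c d → (a :+ b) :- (c :+ d) := (a :- c) :+ (b :- d)) refl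

    scale : ∀ C {ε} → 0ℚ ℚ.< C → 0ℚ ℚ.< ε → ∃ λ η → 0ℚ ℚ.< η × C ℚ.* η ≡ ε
    scale C {ε} 0<C 0<ε = ℚ.1/ C ℚ.* ε , ℚ.positive⁻¹ (ℚ.1/ C ℚ.* ε) ,
        trans (sym (ℚ.*-assoc C (ℚ.1/ C) ε))
          (trans (cong (ℚ._* ε) (ℚ.*-inverseʳ C)) (ℚ.*-identityˡ ε))
      where instance
        C-pos : Positive C
        C-pos = ℚ.positive 0<C
        C-nonZero : NonZero C
        C-nonZero = ℚ.pos⇒nonZero C
        1/C-pos : Positive (ℚ.1/ C)
        1/C-pos = ℚ.1/pos⇒pos C
        ε-pos : Positive ε
        ε-pos = ℚ.positive 0<ε
        prod-pos : Positive (ℚ.1/ C ℚ.* ε)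
        prod-pos = ℚ.pos*pos⇒pos (ℚ.1/ C) ε

    ∣*∣-bound : ∀ C {ε η} p q → 0ℚ ℚ.< C → C ℚ.* η ≡ ε →
                ℚ.∣ p ∣ ℚ.≤ C → ℚ.∣ q ∣ ℚ.< η → ℚ.∣ p ℚ.* q ∣ ℚ.< ε
    ∣*∣-bound C {ε} {η} p q 0<C Cη p≤C q<η = begin-strict
        ℚ.∣ p ℚ.* q ∣          ≡⟨ ℚ.∣p*q∣≡∣p∣*∣q∣ p q ⟩
        ℚ.∣ p ∣ ℚ.* ℚ.∣ q ∣    ≤⟨ ℚ.*-monoʳ-≤-nonNeg ℚ.∣ q ∣ {{ℚ.nonNegative (ℚ.0≤∣p∣ q)}} p≤C ⟩
        C ℚ.* ℚ.∣ q ∣          <⟨ ℚ.*-monoʳ-<-pos C {{ℚ.positive 0<C}} q<η ⟩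
        C ℚ.* η                ≡⟨ Cη ⟩
        ε                      ∎
      where open ℚ.≤-Reasoning

    product-close : ∀ C {ε η} a b c d → 0ℚ ℚ.< C → C ℚ.* η ≡ ½ ℚ.* ε →
                    ℚ.∣ a ∣ ℚ.≤ C → ℚ.∣ d ∣ ℚ.≤ C →
                    ℚ.∣ a ℚ.- c ∣ ℚ.< η → ℚ.∣ b ℚ.- d ∣ ℚ.< η →
                    ℚ.∣ a ℚ.* b ℚ.- c ℚ.* d ∣ ℚ.< ε
    product-close C {ε} a b c d 0<C Cη a≤C d≤C ac<η bd<η = begin-strict
        ℚ.∣ a ℚ.* b ℚ.- c ℚ.* d ∣
          ≡⟨ cong ℚ.∣_∣ (rearrange a b c d) ⟩
        ℚ.∣ a ℚ.* (b ℚ.- d) ℚ.+ d ℚ.* (a ℚ.- c) ∣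
          ≤⟨ ℚ.∣p+q∣≤∣p∣+∣q∣ (a ℚ.* (b ℚ.- d)) (d ℚ.* (a ℚ.- c)) ⟩
        ℚ.∣ a ℚ.* (b ℚ.- d) ∣ ℚ.+ ℚ.∣ d ℚ.* (a ℚ.- c) ∣
          <⟨ ℚ.+-mono-< (∣*∣-bound C a (b ℚ.- d) 0<C Cη a≤C bd<η)
                        (∣*∣-bound C d (a ℚ.- c) 0<C Cη d≤C ac<η) ⟩
        ½ ℚ.* ε ℚ.+ ½ ℚ.* ε  ≡⟨ half+half ε ⟩
        ε                    ∎
      where
      open ℚ.≤-Reasoning
      open +-*-Solver
      rearrange : ∀ a b c d → a ℚ.* b ℚ.- c ℚ.* d ≡ a ℚ.* (b ℚ.- d) ℚ.+ d ℚ.* (a ℚ.- c)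
      rearrange = solve 4 (λ a b c d → a :* b :- c :* d := a :* (b :- d) :+ d :* (a :- c)) refl

    *-cauchy : (x y : ℝ) → IsCauchy (λ n → seq x n ℚ.* seq y n)
    *-cauchy x y ε 0<ε =
      let A , 0<A , N₁ , x<A = bounded x
          B , 0<B , N₂ , y<B = bounded y
          0<C = ℚ.+-mono-< 0<A 0<B
          A≤C = subst (ℚ._≤ A ℚ.+ B) (ℚ.+-identityʳ A) (ℚ.+-monoʳ-≤ A (ℚ.<⇒≤ 0<B))
          B≤C = subst (ℚ._≤ A ℚ.+ B) (ℚ.+-identityˡ B) (ℚ.+-monoˡ-≤ B (ℚ.<⇒≤ 0<A))
          η , 0<η , Cη = scale (A ℚ.+ B) 0<C (half-pos 0<ε)
          N₃ , x-close = cauchy x η 0<η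
          N₄ , y-close = cauchy y η 0<η
          N₁₂ = N₁ ⊔ℕ N₂
          N₃₄ = N₃ ⊔ℕ N₄
      in N₁₂ ⊔ℕ N₃₄ , λ m n N≤m N≤n →
        let m₁₂ = ℕ.m⊔n≤o⇒m≤o N₁₂ N₃₄ N≤m
            m₃₄ = ℕ.m⊔n≤o⇒n≤o N₁₂ N₃₄ N≤m
            n₁₂ = ℕ.m⊔n≤o⇒m≤o N₁₂ N₃₄ N≤n
            n₃₄ = ℕ.m⊔n≤o⇒n≤o N₁₂ N₃₄ N≤n
        in product-close (A ℚ.+ B) (seq x m) (seq y m) (seq x n) (seq y n) 0<C Cη
             (ℚ.≤-trans (ℚ.<⇒≤ (x<A m (ℕ.m⊔n≤o⇒m≤o N₁ N₂ m₁₂))) A≤C)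
             (ℚ.≤-trans (ℚ.<⇒≤ (y<B n (ℕ.m⊔n≤o⇒n≤o N₁ N₂ n₁₂))) B≤C)
             (x-close m n (ℕ.m⊔n≤o⇒m≤o N₃ N₄ m₃₄) (ℕ.m⊔n≤o⇒m≤o N₃ N₄ n₃₄))
             (y-close m n (ℕ.m⊔n≤o⇒n≤o N₃ N₄ m₃₄) (ℕ.m⊔n≤o⇒n≤o N₃ N₄ n₃₄))

_+_ : ℝ → ℝ → ℝ
x + y = mkℝ (λ n → seq x n ℚ.+ seq y n) (+-cauchy x y)

_*_ : ℝ → ℝ → ℝ
x * y = mkℝ (λ n → seq x n ℚ.* seq y n) (*-cauchy x y)

fromℚ : ℚ → ℝ
fromℚ q = mkℝ (λ _ → q) λ ε 0<ε → 0 , λ _ _ _ _ →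
  subst (ℚ._< ε) (sym (cong ℚ.∣_∣ (ℚ.+-inverseʳ q))) 0<ε

0ℝ 4ℝ : ℝ
0ℝ = fromℚ 0ℚ
4ℝ = fromℚ (1ℚ ℚ.+ 1ℚ ℚ.+ 1ℚ ℚ.+ 1ℚ)

-- 1 / max δ p
1/max : (δ : ℚ) → 0ℚ ℚ.< δ → ℚ → ℚ
1/max δ 0<δ p = ℚ.1/_ (δ ℚ.⊔ p) {{ℚ.pos⇒nonZero (δ ℚ.⊔ p) {{ℚ.positive (ℚ.<-≤-trans 0<δ (ℚ.p≤p⊔q δ p))}}}}

private
  abstract

    1/-close : ∀ δ {ε} a b .{{_ : NonZero a}} .{{_ : NonZero b}} →
               0ℚ ℚ.< δ → δ ℚ.≤ a → δ ℚ.≤ b →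
               ℚ.∣ a ℚ.- b ∣ ℚ.< δ ℚ.* δ ℚ.* ε → ℚ.∣ ℚ.1/ a ℚ.- ℚ.1/ b ∣ ℚ.< ε
    1/-close δ {ε} a b 0<δ δ≤a δ≤b a-b<η =
        go (ℚ.1/ a) (ℚ.1/ b) (ℚ.*-inverseˡ a) (ℚ.*-inverseˡ b)
      where
      open ℚ.≤-Reasoning
      open +-*-Solver
      instance
        δ-nonNeg : NonNegative δ
        δ-nonNeg = ℚ.nonNegative (ℚ.<⇒≤ 0<δ)
        b-nonNeg : NonNegative b
        b-nonNeg = ℚ.nonNegative (ℚ.≤-trans (ℚ.<⇒≤ 0<δ) δ≤b)
        δδ-nonNeg : NonNegative (δ ℚ.* δ)
        δδ-nonNeg = ℚ.nonNeg*nonNeg⇒nonNeg δ δ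
      δδ≤ab : δ ℚ.* δ ℚ.≤ a ℚ.* b
      δδ≤ab = ℚ.≤-trans (ℚ.*-monoˡ-≤-nonNeg δ δ≤b) (ℚ.*-monoʳ-≤-nonNeg b δ≤a)
      rearrange : ∀ p q a b → (a ℚ.* b) ℚ.* (p ℚ.- q) ≡ (p ℚ.* a) ℚ.* b ℚ.- (q ℚ.* b) ℚ.* a
      rearrange = solve 4 (λ p q a b →
        (a :* b) :* (p :- q) := (p :* a) :* b :- (q :* b) :* a) refl
      swap : ∀ a b → b ℚ.- a ≡ ℚ.- (a ℚ.- b)
      swap = solve 2 (λ a b → b :- a := :- (a :- b)) refl
      go : ∀ p q → p ℚ.* a ≡ 1ℚ → q ℚ.* b ≡ 1ℚ → ℚ.∣ p ℚ.- q ∣ ℚ.< ε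
      go p q pa qb = ℚ.*-cancelˡ-<-nonNeg (δ ℚ.* δ) (begin-strict
        δ ℚ.* δ ℚ.* ℚ.∣ p ℚ.- q ∣
          ≤⟨ ℚ.*-monoʳ-≤-nonNeg ℚ.∣ p ℚ.- q ∣ {{ℚ.nonNegative (ℚ.0≤∣p∣ (p ℚ.- q))}} δδ≤ab ⟩
        a ℚ.* b ℚ.* ℚ.∣ p ℚ.- q ∣
          ≡⟨ cong (ℚ._* ℚ.∣ p ℚ.- q ∣)
               (sym (ℚ.0≤p⇒∣p∣≡p (ℚ.≤-trans (ℚ.nonNegative⁻¹ (δ ℚ.* δ)) δδ≤ab))) ⟩
        ℚ.∣ a ℚ.* b ∣ ℚ.* ℚ.∣ p ℚ.- q ∣
          ≡⟨ sym (ℚ.∣p*q∣≡∣p∣*∣q∣ (a ℚ.* b) (p ℚ.- q)) ⟩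
        ℚ.∣ a ℚ.* b ℚ.* (p ℚ.- q) ∣
          ≡⟨ cong ℚ.∣_∣ (rearrange p q a b) ⟩
        ℚ.∣ (p ℚ.* a) ℚ.* b ℚ.- (q ℚ.* b) ℚ.* a ∣
          ≡⟨ cong₂ (λ s t → ℚ.∣ s ℚ.* b ℚ.- t ℚ.* a ∣) pa qb ⟩
        ℚ.∣ 1ℚ ℚ.* b ℚ.- 1ℚ ℚ.* a ∣
          ≡⟨ cong₂ (λ s t → ℚ.∣ s ℚ.- t ∣) (ℚ.*-identityˡ b) (ℚ.*-identityˡ a) ⟩
        ℚ.∣ b ℚ.- a ∣         ≡⟨ cong ℚ.∣_∣ (swap a b) ⟩
        ℚ.∣ ℚ.- (a ℚ.- b) ∣   ≡⟨ ℚ.∣-p∣≡∣p∣ (a ℚ.- b) ⟩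
        ℚ.∣ a ℚ.- b ∣         <⟨ a-b<η ⟩
        δ ℚ.* δ ℚ.* ε         ∎)

    recip-cauchy : (x : ℝ) ((δ , 0<δ , _) : 0ℝ < x) → IsCauchy (λ n → 1/max δ 0<δ (seq x n))
    recip-cauchy x (δ , 0<δ , N₁ , δ≤x) ε 0<ε =
      let N₂ , x-close = cauchy x (δ ℚ.* δ ℚ.* ε) 0<η
      in N₁ ⊔ℕ N₂ , λ m n N≤m N≤n →
        1/-close δ (δ ℚ.⊔ seq x m) (δ ℚ.⊔ seq x n) {{max-nonZero (seq x m)}} {{max-nonZero (seq x n)}}
          0<δ (ℚ.p≤p⊔q δ (seq x m)) (ℚ.p≤p⊔q δ (seq x n))
          (subst₂ (λ s t → ℚ.∣ s ℚ.- t ∣ ℚ.< δ ℚ.* δ ℚ.* ε)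
            (sym (max≡ m (ℕ.m⊔n≤o⇒m≤o N₁ N₂ N≤m))) (sym (max≡ n (ℕ.m⊔n≤o⇒m≤o N₁ N₂ N≤n)))
            (x-close m n (ℕ.m⊔n≤o⇒n≤o N₁ N₂ N≤m) (ℕ.m⊔n≤o⇒n≤o N₁ N₂ N≤n)))
      where
      instance
        δ-pos : Positive δ
        δ-pos = ℚ.positive 0<δ
        ε-pos : Positive ε
        ε-pos = ℚ.positive 0<ε
        δδ-pos : Positive (δ ℚ.* δ)
        δδ-pos = ℚ.pos*pos⇒pos δ δ
        η-pos : Positive (δ ℚ.* δ ℚ.* ε)
        η-pos = ℚ.pos*pos⇒pos (δ ℚ.* δ) ε
      0<η : 0ℚ ℚ.< δ ℚ.* δ ℚ.* ε
      0<η = ℚ.positive⁻¹ (δ ℚ.* δ ℚ.* ε)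
      max-nonZero : ∀ p → NonZero (δ ℚ.⊔ p)
      max-nonZero p = ℚ.pos⇒nonZero (δ ℚ.⊔ p) {{ℚ.positive (ℚ.<-≤-trans 0<δ (ℚ.p≤p⊔q δ p))}}
      max≡ : ∀ n → N₁ ≤ℕ n → δ ℚ.⊔ seq x n ≡ seq x n
      max≡ n N≤n = ℚ.p≤q⇒p⊔q≡q (subst (ℚ._≤ seq x n) (ℚ.+-identityˡ δ) (δ≤x n N≤n))

-- If x is eventually at least δ > 0, then max δ (seq x n) eventually equals
-- seq x n; the maximum only keeps the finitely many other terms invertible.
recip : (x : ℝ) → 0ℝ < x → ℝ
recip x 0<x@(δ , 0<δ , _) =
  mkℝ (λ n → 1/max δ 0<δ (seq x n)) (recip-cauchy x 0<x)

------------------------------------------------------------------------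
-- Instances

-- Finite sets are represented by lists; repetitions are removed before
-- counting or summing.

record Instance : Set₁ where
  field
    U   : Set
    _≟_ : DecidableEquality U
    ν   : U → ℝ
    ν≥0 : ∀ u → 0ℝ ≤ ν u

  Ω : Set
  Ω = U × ℕ

  _≟Ω_ : DecidableEquality Ω
  _≟Ω_ = ≡-dec _≟_ ℕ._≟_

  weight : List U → ℝ
  weight X = foldr _+_ 0ℝ (map ν (deduplicate _≟_ X))

  f : List Ω → ℝ
  f S = weight (map proj₁ S)

  card : List Ω → ℕ
  card S = length (deduplicate _≟Ω_ S)

  _∩Ω_ : List Ω → ℕ → List Ω
  S ∩Ω i = filter (λ e → proj₂ e ℕ.≟ i) S

  Independent : List Ω → Set
  Independent S = ∀ i → card (S ∩Ω i) ≤ℕ 1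

  independent? : ∀ S → Dec (Independent S)
  independent? S = map′ extend (λ ind → All.tabulate (λ {i} _ → ind i))
                     (all? (λ i → card (S ∩Ω i) ℕ.≤? 1) (map proj₂ S))
    where
    open DecMembership ℕ._≟_ using (_∈?_)
    extend : All (λ i → card (S ∩Ω i) ≤ℕ 1) (map proj₂ S) → Independent S
    extend ok i with i ∈? map proj₂ S
    ... | yes i∈ = All-lookup ok i∈
    ... | no  i∉ = subst (λ T → card T ≤ℕ 1) (sym empty) z≤n
      where
      empty : S ∩Ω i ≡ []
      empty = filter-none (λ e → proj₂ e ℕ.≟ i)
        (All.tabulate λ e∈S eq → i∉ (subst (_∈ˡ map proj₂ S) eq (∈-map⁺ proj₂ e∈S)))

  IsOPT : List Ω → List Ω → Set
  IsOPT σ T = T ⊆ˡ σ × Independent T ×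
              (∀ T′ → T′ ⊆ˡ σ → Independent T′ → f T′ ≤ f T)

  select : (σ : List Ω) → Subset (length σ) → List Ω
  select []      []            = []
  select (e ∷ σ) (inside  ∷ S) = e ∷ select σ S
  select (e ∷ σ) (outside ∷ S) = select σ S

------------------------------------------------------------------------
-- Online algorithms

-- The sequence of arrived elements is a list with the latest arrival at the
-- head, and sets of arrived elements are subsets of its positions.  When the
-- (n+1)-st element arrives, at position 0, a policy receives the value and
-- independence oracles on the n+1 elements that have arrived and the solution
-- held so far, and returns the new solution.  It sees the elements only through
-- the oracles, never U, ν or the labels in Ω.
Policy : Set
Policy = ∀ {n} → (Subset (suc n) → ℝ) → (Subset (suc n) → Bool) →
         Subset n → Subset (suc n)

module _ (I : Instance) where
  open Instance I

  run : Policy → (σ : List Ω) → Subset (length σ)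
  run step []      = []
  run step (e ∷ σ) = step (λ T → f (select (e ∷ σ) T))
                          (λ T → does (independent? (select (e ∷ σ) T)))
                          (run step σ)

  solution : Policy → (σ : List Ω) → List Ω
  solution step σ = select σ (run step σ)

-- Decisions depend on the oracle answers only, real answers being compared by _≈_.
Extensional : Policy → Set
Extensional step =
  ∀ {n} {v v′ : Subset (suc n) → ℝ} {o o′ : Subset (suc n) → Bool} (S : Subset n) →
  (∀ T → v T ≈ v′ T) → (∀ T → o T ≡ o′ T) → step v o S ≡ step v′ o′ S

-- Only the arriving element can be added.
NoRetrieval : Policy → Set₁
NoRetrieval step = ∀ I (e : Instance.Ω I) σ → Unique (e ∷ σ) →
  run I step (e ∷ σ) ⊆ˢ inside ∷ run I step σ

KeepsIndependent : Policy → Set₁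
KeepsIndependent step = ∀ I σ → Unique σ → Instance.Independent I (solution I step σ)

record Algorithm : Set₁ where
  field
    step             : Policy
    extensional      : Extensional step
    noRetrieval      : NoRetrieval step
    keepsIndependent : KeepsIndependent step

StrictlyMonotone : Algorithm → Set₁
StrictlyMonotone A = ∀ I → let open Instance I in ∀ e σ → Unique (e ∷ σ) →
  head (run I step (e ∷ σ)) ≡ inside →
  f (solution I step σ) < f (solution I step (e ∷ σ))
  where open Algorithm A

HasCompetitiveRatio : Algorithm → ℝ → Set₁
HasCompetitiveRatio A r = ∀ I → let open Instance I in ∀ σ → Unique σ →
  ∀ T → IsOPT σ T → r * f T ≤ f (solution I step σ)
  where open Algorithm A

{-# OPTIONS --safe #-}
module Submission where

-- Adversary: the arrivals are (0 , 0), (0 , 1), (1 , 0), (1 , 2), (2 , 0), (2 , 3), …  While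
-- the algorithm holds item j in slot 0, strict monotonicity makes it reject the copy
-- (j , j + 1), whereas the optimum uses every copy.  Stopping when the algorithm refuses
-- (j + 1 , 0) leaves it with x j against x 0 + … + x (j + 1), and stopping at the last item
-- leaves it with x N against x 0 + … + x N.  For every ρ > 1/4 there are weights x for
-- which ρ times the optimum exceeds the algorithm's value at each of these stops.

open import Defs
open import Relation.Nullary using (¬_; yes; no)

open import Algebra.Bundles using (CommutativeRing)
import Data.Nat.Properties as ℕ
open import Data.Empty using (⊥; ⊥-elim)
open import Data.Fin.Subset using (Subset; inside; outside) renaming (⊥ to ∅; _⊆_ to _⊆ˢ_)
open import Data.Fin.Subset.Properties using (⊆-antisym; ⊥⊆; drop-∷-⊆)
open import Data.Integer.Base as ℤ using (+_; +[1+_]; -[1+_])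
import Data.Integer.Properties as ℤ
open import Data.List.Base using (List; []; _∷_; _++_; map; deduplicate; foldr; length; downFrom)
open import Data.List.Membership.Propositional using (_∈_)
open import Data.List.Membership.Propositional.Properties
  using (∈-filter⁺; ∈-map⁻; ∈-∃++; ∈-deduplicate⁺; ∈-deduplicate⁻; ∈-downFrom⁺)
open import Data.List.Properties using (filter-none; filter-accept; filter-reject; map-∘; map-id)
open import Data.List.Relation.Binary.Permutation.Propositional.Properties using (shift; map⁺; ∈-resp-↭)
open import Data.List.Relation.Binary.Subset.Propositional using (_⊆_)
open import Data.List.Relation.Unary.All as All using (All; []; _∷_)
import Data.List.Relation.Unary.All.Properties as All
open import Data.List.Relation.Unary.AllPairs using ([]; _∷_)
open import Data.List.Relation.Unary.Any using (here; there)
open import Data.List.Relation.Unary.Unique.DecPropositional.Properties ℕ._≟_ using (deduplicate-!)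
open import Data.List.Relation.Unary.Unique.Propositional using (Unique)
open import Data.List.Relation.Unary.Unique.Propositional.Properties as Unique using (downFrom⁺)
open import Data.Nat.Base as ℕ using (ℕ; zero; suc; z≤n; s≤s; _^_)
open import Data.Nat.ListAction using (sum)
open import Data.Nat.ListAction.Properties using (sum-↭)
open import Data.Nat.Solver using (module +-*-Solver)
open import Data.Product.Base using (∃; _×_; _,_; proj₁; proj₂)
open import Data.Rational.Base as ℚ using (ℚ; mkℚ; 0ℚ; 1ℚ; toℚᵘ)
import Data.Rational.Properties as ℚ
import Data.Rational.Solver as ℚ
open import Data.Rational.Unnormalised.Base as ℚᵘ using (mkℚᵘ; *≡*; *≤*)
import Data.Rational.Unnormalised.Properties as ℚᵘ
open import Data.Vec.Base using ([]; _∷_; here; there; head)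
open import Function.Base using (_∘_; case_of_)
open import Relation.Binary.PropositionalEquality

open import Algebra.Properties.Semiring.Mult (CommutativeRing.semiring ℚ.+-*-commutativeRing)
  using (×-homo-+; ×1-homo-*) renaming (_×_ to _·_)

-- Natural numbers inside the rationals

fromℕ : ℕ → ℚ
fromℕ n = n · 1ℚ

0≤fromℕ : ∀ n → 0ℚ ℚ.≤ fromℕ n
0≤fromℕ zero    = ℚ.≤-refl
0≤fromℕ (suc n) = ℚ.+-mono-≤ (ℚ.<⇒≤ (ℚ.positive⁻¹ 1ℚ)) (0≤fromℕ n)

fromℕ-mono-≤ : ∀ {m n} → m ℕ.≤ n → fromℕ m ℚ.≤ fromℕ n
fromℕ-mono-≤ {n = n} z≤n = 0≤fromℕ n
fromℕ-mono-≤ (s≤s m≤n)   = ℚ.+-monoʳ-≤ 1ℚ (fromℕ-mono-≤ m≤n)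

fromℕ-pos : ∀ n → 0ℚ ℚ.< fromℕ (suc n)
fromℕ-pos n = ℚ.+-mono-<-≤ (ℚ.positive⁻¹ 1ℚ) (0≤fromℕ n)

toℚᵘ-fromℕ : ∀ n → toℚᵘ (fromℕ n) ℚᵘ.≃ mkℚᵘ (+ n) 0
toℚᵘ-fromℕ zero    = ℚᵘ.≃-refl
toℚᵘ-fromℕ (suc n) = ℚᵘ.≃-trans (ℚ.toℚᵘ-homo-+ 1ℚ (fromℕ n))
  (ℚᵘ.≃-trans (ℚᵘ.+-congʳ (toℚᵘ 1ℚ) (toℚᵘ-fromℕ n))
    (*≡* (cong (ℤ._* ℤ.1ℤ) (cong (λ z → ℤ.1ℤ ℤ.+ z) (ℤ.*-identityʳ (+ n))))))

-- For δ = (k + 1) / (n + 1) the denominator itself serves as multiplier: (n + 1) δ = k + 1.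
archimedean : ∀ δ → 0ℚ ℚ.< δ → ∃ λ n → 1ℚ ℚ.≤ fromℕ (suc n) ℚ.* δ
archimedean δ@(mkℚ +[1+ k ] n _) _ = n , ℚ.toℚᵘ-cancel-≤ (begin
  toℚᵘ 1ℚ                          ≤⟨ *≤* bound ⟩
  mkℚᵘ (+ suc n) 0 ℚᵘ.* toℚᵘ δ     ≃⟨ ℚᵘ.*-congʳ (toℚᵘ-fromℕ (suc n)) ⟨
  toℚᵘ (fromℕ (suc n)) ℚᵘ.* toℚᵘ δ ≃⟨ ℚ.toℚᵘ-homo-* (fromℕ (suc n)) δ ⟨
  toℚᵘ (fromℕ (suc n) ℚ.* δ)       ∎)
  where
  open ℚᵘ.≤-Reasoning
  bound : + 1 ℤ.* + (1 ℕ.* suc n) ℤ.≤ (+ suc n ℤ.* +[1+ k ]) ℤ.* + 1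
  bound = subst₂ ℤ._≤_ (trans (cong +_ (sym (ℕ.*-identityˡ (suc n)))) (sym (ℤ.*-identityˡ (+ (1 ℕ.* suc n)))))
    (sym (trans (ℤ.*-identityʳ _) (sym (ℤ.pos-* (suc n) (suc k)))))
    (ℤ.+≤+ (ℕ.m≤m*n (suc n) (suc k)))
archimedean (mkℚ (+ 0) _ _)      (ℚ.*<* (ℤ.+<+ ()))
archimedean (mkℚ -[1+ _ ] _ _) (ℚ.*<* ())

p<p+q : ∀ p {q} → 0ℚ ℚ.< q → p ℚ.< p ℚ.+ q
p<p+q p {q} 0<q = subst (ℚ._< p ℚ.+ q) (ℚ.+-identityʳ p) (ℚ.+-monoʳ-< p 0<q)

-- The rational margin above 1/4

4ℚ ¼ : ℚ
4ℚ = fromℕ 4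
¼  = ℚ.1/ 4ℚ

¼≤1/p : ∀ p .{{_ : ℚ.Positive p}} → p ℚ.≤ 4ℚ → ¼ ℚ.≤ ℚ.1/_ p {{ℚ.pos⇒nonZero p}}
¼≤1/p p p≤4 = begin
  ¼                     ≡⟨ ℚ.*-identityʳ ¼ ⟨
  ¼ ℚ.* 1ℚ              ≡⟨ cong (¼ ℚ.*_) (ℚ.*-inverseʳ p) ⟨
  ¼ ℚ.* (p ℚ.* ℚ.1/ p)  ≡⟨ ℚ.*-assoc ¼ p (ℚ.1/ p) ⟨
  ¼ ℚ.* p ℚ.* ℚ.1/ p    ≤⟨ ℚ.*-monoʳ-≤-nonNeg (ℚ.1/ p) (ℚ.*-monoˡ-≤-nonNeg ¼ p≤4) ⟩
  1ℚ ℚ.* ℚ.1/ p         ≡⟨ ℚ.*-identityˡ (ℚ.1/ p) ⟩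
  ℚ.1/ p                ∎
  where
  open ℚ.≤-Reasoning
  instance
    p-nonZero : ℚ.NonZero p
    p-nonZero = ℚ.pos⇒nonZero p
    1/p-nonNeg : ℚ.NonNegative (ℚ.1/ p)
    1/p-nonNeg = ℚ.pos⇒nonNeg (ℚ.1/ p) {{ℚ.1/pos⇒pos p}}

EventuallyAtLeast : ℚ → ℝ → Set
EventuallyAtLeast p x = ∃ λ N → ∀ n → N ℕ.≤ n → p ℚ.≤ seq x n

-- On a common tail `seq α n` lies between the bound in `0<α` and 4, so the maximum inside `recip`
-- is at most 4 and its inverse at least 1/4. The gap between `recip α 0<α` and `r` then survives as
-- a rational margin.
above-recip : ∀ α (0<α : 0ℝ < α) → α < 4ℝ → ∀ r → recip α 0<α < r →
              ∃ λ δ → 0ℚ ℚ.< δ × EventuallyAtLeast (¼ ℚ.+ δ) r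
above-recip α (δ , 0<δ , N₁ , δ≤α) (ε , 0<ε , N₂ , α+ε≤4) r (η , 0<η , N₃ , 1/α+η≤r) =
  η , 0<η , N₁ ℕ.⊔ (N₂ ℕ.⊔ N₃) , λ n N≤n →
    let N₁≤n = ℕ.m⊔n≤o⇒m≤o N₁ (N₂ ℕ.⊔ N₃) N≤n
        N₂≤n = ℕ.m⊔n≤o⇒m≤o N₂ N₃ (ℕ.m⊔n≤o⇒n≤o N₁ (N₂ ℕ.⊔ N₃) N≤n)
        N₃≤n = ℕ.m⊔n≤o⇒n≤o N₂ N₃ (ℕ.m⊔n≤o⇒n≤o N₁ (N₂ ℕ.⊔ N₃) N≤n)
        α≤4  = ℚ.≤-trans (ℚ.<⇒≤ (p<p+q (seq α n) 0<ε)) (α+ε≤4 n N₂≤n)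
        δ≤α′ = subst (ℚ._≤ seq α n) (ℚ.+-identityˡ δ) (δ≤α n N₁≤n)
    in ℚ.≤-trans
         (ℚ.+-monoˡ-≤ η (¼≤1/p (δ ℚ.⊔ seq α n)
           {{ℚ.positive (ℚ.<-≤-trans 0<δ (ℚ.p≤p⊔q δ (seq α n)))}}
           (ℚ.⊔-lub (ℚ.≤-trans δ≤α′ α≤4) α≤4)))
         (1/α+η≤r n N₃≤n)

-- Length of the game and weights of the items

-- The quotient (N + 3) / (4 (N + 1)) bounds the algorithm's ratio at every stop and tends to 1/4.
-- Once N δ is at least 1, the right side is at least N + 5.
horizon : ∀ δ → 0ℚ ℚ.< δ → ∃ λ n → let N = suc n in
          fromℕ (3 ℕ.+ N) ℚ.< (¼ ℚ.+ δ) ℚ.* fromℕ (4 ℕ.* suc N)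
horizon δ 0<δ with archimedean δ 0<δ
... | n , 1≤Nδ = n , (begin-strict
  -- The slack of 2 fits by computation: 3 + 2 = 1 + 4 * 1.
  fromℕ (3 ℕ.+ N)                             ≡⟨ lhs (fromℕ N) ⟩
  fromℕ N ℚ.+ fromℕ 3                         <⟨ ℚ.+-monoʳ-< (fromℕ N) (p<p+q (fromℕ 3) (fromℕ-pos 1)) ⟩
  fromℕ N ℚ.+ (1ℚ ℚ.+ 4ℚ ℚ.* 1ℚ)
    ≤⟨ ℚ.+-monoʳ-≤ (fromℕ N) (ℚ.+-monoʳ-≤ 1ℚ (ℚ.*-monoˡ-≤-nonNeg 4ℚ 1≤δ+Nδ)) ⟩
  fromℕ N ℚ.+ (1ℚ ℚ.+ 4ℚ ℚ.* (δ ℚ.+ fromℕ N ℚ.* δ)) ≡⟨ rhs (fromℕ N) δ ⟩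
  (¼ ℚ.+ δ) ℚ.* (4ℚ ℚ.* fromℕ (suc N))        ≡⟨ cong ((¼ ℚ.+ δ) ℚ.*_) (×1-homo-* 4 (suc N)) ⟨
  (¼ ℚ.+ δ) ℚ.* fromℕ (4 ℕ.* suc N)           ∎)
  where
  N = suc n
  open ℚ.≤-Reasoning
  open ℚ.+-*-Solver
  1≤δ+Nδ : 1ℚ ℚ.≤ δ ℚ.+ fromℕ N ℚ.* δ
  1≤δ+Nδ = subst (ℚ._≤ δ ℚ.+ fromℕ N ℚ.* δ) (ℚ.+-identityˡ 1ℚ) (ℚ.+-mono-≤ (ℚ.<⇒≤ 0<δ) 1≤Nδ)
  lhs : ∀ x → 1ℚ ℚ.+ (1ℚ ℚ.+ (1ℚ ℚ.+ x)) ≡ x ℚ.+ fromℕ 3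
  lhs = solve 1 (λ x → con 1ℚ :+ (con 1ℚ :+ (con 1ℚ :+ x)) := x :+ con (fromℕ 3)) refl
  rhs : ∀ x δ → x ℚ.+ (1ℚ ℚ.+ 4ℚ ℚ.* (δ ℚ.+ x ℚ.* δ)) ≡ (¼ ℚ.+ δ) ℚ.* (4ℚ ℚ.* (1ℚ ℚ.+ x))
  rhs = solve 2 (λ x δ → x :+ (con 1ℚ :+ con 4ℚ :* (δ :+ x :* δ))
                      := (con ¼ :+ δ) :* (con 4ℚ :* (con 1ℚ :+ x))) refl

-- Cross-multiplication keeps the bounds on the weights in ℕ. The successor makes the denominator
-- positive, so that strictness survives multiplication by it.
scaled-< : ∀ ρ k l → fromℕ l ℚ.< ρ ℚ.* fromℕ k →
           ∀ {a b} → k ℕ.* a ℕ.≤ l ℕ.* suc b → fromℕ a ℚ.< ρ ℚ.* fromℕ (suc b)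
scaled-< ρ k l l<ρk {a} {b} ka≤lb = ℚ.*-cancelˡ-<-nonNeg (fromℕ k)
  {{ℚ.nonNegative (0≤fromℕ k)}} (begin-strict
  fromℕ k ℚ.* fromℕ a               ≡⟨ ×1-homo-* k a ⟨
  fromℕ (k ℕ.* a)                   ≤⟨ fromℕ-mono-≤ ka≤lb ⟩
  fromℕ (l ℕ.* suc b)               ≡⟨ ×1-homo-* l (suc b) ⟩
  fromℕ l ℚ.* fromℕ (suc b)         <⟨ ℚ.*-monoˡ-<-pos (fromℕ (suc b)) {{ℚ.positive (fromℕ-pos b)}} l<ρk ⟩
  ρ ℚ.* fromℕ k ℚ.* fromℕ (suc b)   ≡⟨ rearrange ρ (fromℕ k) (fromℕ (suc b)) ⟩
  fromℕ k ℚ.* (ρ ℚ.* fromℕ (suc b)) ∎)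
  where
  open ℚ.≤-Reasoning
  open ℚ.+-*-Solver
  rearrange : ∀ x y z → x ℚ.* y ℚ.* z ≡ y ℚ.* (x ℚ.* z)
  rearrange = solve 3 (λ x y z → x :* y :* z := y :* (x :* z)) refl

-- The successive differences of s j = 2 ^ (j + 1) * (j + 1) * (N ∸ j + 1).  The factor
-- 2 ^ j * (j + 1) solves the critical recurrence s (j + 1) = 4 * (s j - s (j - 1)); the
-- concave factor N ∸ j + 1 ends the game after finitely many rounds.
itemWeight : ℕ → ℕ → ℕ
itemWeight N j = 2 ^ j ℕ.* ((N ℕ.∸ j) ℕ.* (2 ℕ.+ j) ℕ.+ 2)

total : (ℕ → ℕ) → ℕ → ℕ
total w n = sum (map w (downFrom n))

itemWeight-+ : ∀ j p → itemWeight (j ℕ.+ p) j ≡ 2 ^ j ℕ.* (p ℕ.* (2 ℕ.+ j) ℕ.+ 2)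
itemWeight-+ j p = cong (λ q → 2 ^ j ℕ.* (q ℕ.* (2 ℕ.+ j) ℕ.+ 2)) (ℕ.m+n∸m≡n j p)

-- Telescoping to the closed form of s j. With N written as j + p there is no truncated subtraction;
-- the induction lowers j and raises p, so N stays fixed.
total-itemWeight : ∀ j p → total (itemWeight (j ℕ.+ p)) (suc j) ≡ 2 ^ suc j ℕ.* (suc j ℕ.* suc p)
total-itemWeight zero p =
  solve 1 (λ p → con 1 :* (p :* con 2 :+ con 2) :+ con 0
              := con 2 :* (con 1 :* (con 1 :+ p))) refl p
  where open +-*-Solver
total-itemWeight (suc j) p = begin
  itemWeight (suc j ℕ.+ p) (suc j) ℕ.+ total (itemWeight (suc j ℕ.+ p)) (suc j)
    ≡⟨ cong₂ (λ x N → x ℕ.+ total (itemWeight N) (suc j)) (itemWeight-+ (suc j) p) (sym (ℕ.+-suc j p)) ⟩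
  2 ^ suc j ℕ.* (p ℕ.* (3 ℕ.+ j) ℕ.+ 2) ℕ.+ total (itemWeight (j ℕ.+ suc p)) (suc j)
    ≡⟨ cong (2 ^ suc j ℕ.* (p ℕ.* (3 ℕ.+ j) ℕ.+ 2) ℕ.+_) (total-itemWeight j (suc p)) ⟩
  2 ^ suc j ℕ.* (p ℕ.* (3 ℕ.+ j) ℕ.+ 2) ℕ.+ 2 ^ suc j ℕ.* (suc j ℕ.* (2 ℕ.+ p))
    ≡⟨ solve 3 (λ c j p → c :* (p :* (con 3 :+ j) :+ con 2) :+ c :* ((con 1 :+ j) :* (con 2 :+ p))
                       := con 2 :* c :* ((con 2 :+ j) :* (con 1 :+ p))) refl (2 ^ suc j) j p ⟩
  2 ^ suc (suc j) ℕ.* (suc (suc j) ℕ.* suc p) ∎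
  where
  open ≡-Reasoning
  open +-*-Solver

total-suc : ∀ j p → ∃ λ b → total (itemWeight (j ℕ.+ p)) (suc j) ≡ suc b
total-suc j p with total (itemWeight (j ℕ.+ p)) (suc j) | total-itemWeight j p
... | suc b | _ = b , refl
... | zero  | 0≡ = ⊥-elim (ℕ.<-irrefl 0≡ (ℕ.*-mono-≤ (ℕ.m^n>0 2 (suc j)) (ℕ.s≤s z≤n)))

-- With q = (p + 1) (j + 2), the item weighs 2 ^ j (q + 2) and the total is 4 * 2 ^ j * q. The
-- quotient is 1/4 + 1 / (2 q), and q is at least N + 1.
reject-bound : ∀ j p → let N = j ℕ.+ suc p in
  4 ℕ.* suc N ℕ.* itemWeight N j ℕ.≤ (3 ℕ.+ N) ℕ.* total (itemWeight N) (2 ℕ.+ j)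
reject-bound j p = begin
  4 ℕ.* suc N ℕ.* itemWeight N j
    ≡⟨ cong (4 ℕ.* suc N ℕ.*_) (itemWeight-+ j (suc p)) ⟩
  4 ℕ.* suc N ℕ.* (2 ^ j ℕ.* (q ℕ.+ 2))
    ≡⟨ solve 3 (λ N c q → con 4 :* (con 1 :+ N) :* (c :* (q :+ con 2))
                        := con 4 :* c :* (con 2 :* (con 1 :+ N) :+ (con 1 :+ N) :* q)) refl N (2 ^ j) q ⟩
  4 ℕ.* 2 ^ j ℕ.* (2 ℕ.* suc N ℕ.+ suc N ℕ.* q)
    ≤⟨ ℕ.*-monoʳ-≤ (4 ℕ.* 2 ^ j) (ℕ.+-monoˡ-≤ (suc N ℕ.* q) (ℕ.*-monoʳ-≤ 2 N<q)) ⟩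
  4 ℕ.* 2 ^ j ℕ.* (2 ℕ.* q ℕ.+ suc N ℕ.* q)
    ≡⟨ solve 4 (λ N c j p → let q = (con 1 :+ p) :* (con 2 :+ j) in
                          con 4 :* c :* (con 2 :* q :+ (con 1 :+ N) :* q)
                       := (con 3 :+ N) :* (con 2 :* (con 2 :* c) :* ((con 2 :+ j) :* (con 1 :+ p))))
             refl N (2 ^ j) j p ⟩
  (3 ℕ.+ N) ℕ.* (2 ^ (2 ℕ.+ j) ℕ.* ((2 ℕ.+ j) ℕ.* suc p))
    ≡⟨ cong ((3 ℕ.+ N) ℕ.*_) (total-itemWeight (suc j) p) ⟨
  (3 ℕ.+ N) ℕ.* total (itemWeight (suc j ℕ.+ p)) (2 ℕ.+ j)
    ≡⟨ cong (λ M → (3 ℕ.+ N) ℕ.* total (itemWeight M) (2 ℕ.+ j)) (ℕ.+-suc j p) ⟨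
  (3 ℕ.+ N) ℕ.* total (itemWeight N) (2 ℕ.+ j) ∎
  where
  N = j ℕ.+ suc p
  q = suc p ℕ.* (2 ℕ.+ j)
  open ℕ.≤-Reasoning
  open +-*-Solver
  N<q : suc N ℕ.≤ q
  N<q = ℕ.≤-trans (ℕ.m≤m+n (suc N) (p ℕ.+ p ℕ.* j)) (ℕ.≤-reflexive
    (solve 2 (λ j p → con 1 :+ (j :+ (con 1 :+ p)) :+ (p :+ p :* j)
                   := (con 1 :+ p) :* (con 2 :+ j)) refl j p))

-- Here the quotient is exactly 1 / (N + 1), and 4 is at most N + 3 because N is positive.
final-bound : ∀ n → let N = suc n in
  4 ℕ.* suc N ℕ.* itemWeight N N ℕ.≤ (3 ℕ.+ N) ℕ.* total (itemWeight N) (suc N)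
-- The closed forms expect the horizon as `N + 0`, so only its occurrences are generalised to `M`.
final-bound n = subst (λ M → 4 ℕ.* suc N ℕ.* itemWeight M N ℕ.≤ (3 ℕ.+ N) ℕ.* total (itemWeight M) (suc N))
  (ℕ.+-identityʳ N) (begin
  4 ℕ.* suc N ℕ.* itemWeight (N ℕ.+ 0) N
    ≡⟨ cong (4 ℕ.* suc N ℕ.*_) (itemWeight-+ N 0) ⟩
  4 ℕ.* suc N ℕ.* (2 ^ N ℕ.* 2)
    ≡⟨ solve 2 (λ N c → con 4 :* (con 1 :+ N) :* (c :* con 2)
                     := con 4 :* (con 2 :* c :* ((con 1 :+ N) :* con 1))) refl N (2 ^ N) ⟩
  4 ℕ.* (2 ^ suc N ℕ.* (suc N ℕ.* 1))
    ≤⟨ ℕ.*-monoˡ-≤ (2 ^ suc N ℕ.* (suc N ℕ.* 1)) (ℕ.m≤m+n 4 n) ⟩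
  (3 ℕ.+ N) ℕ.* (2 ^ suc N ℕ.* (suc N ℕ.* 1))
    ≡⟨ cong ((3 ℕ.+ N) ℕ.*_) (total-itemWeight N 0) ⟨
  (3 ℕ.+ N) ℕ.* total (itemWeight (N ℕ.+ 0)) (suc N) ∎)
  where
  N = suc n
  open ℕ.≤-Reasoning
  open +-*-Solver

-- Independence through slots, and sums over sublists

slots-distinct⇒independent : ∀ I → let open Instance I in
  ∀ S → Unique (map proj₂ S) → Independent S
slots-distinct⇒independent I []      []              i = z≤n
slots-distinct⇒independent I (e ∷ S) (e∉S ∷ S-unique) i with proj₂ e ℕ.≟ i
... | no  e≢i = subst (λ X → Instance.card I X ℕ.≤ 1)
                  (sym (filter-reject (λ x → proj₂ x ℕ.≟ i) e≢i))
                  (slots-distinct⇒independent I S S-unique i)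
... | yes e≡i = subst (λ X → Instance.card I X ℕ.≤ 1)
                  (sym (trans (filter-accept (λ x → proj₂ x ℕ.≟ i) e≡i)
                         (cong (e ∷_) (filter-none (λ x → proj₂ x ℕ.≟ i)
                           (All.map (λ e≢x x≡i → e≢x (trans e≡i (sym x≡i))) (All.map⁻ e∉S))))))
                  (s≤s z≤n)

∈-length≤1 : ∀ {A : Set} {x y : A} {X} → length X ℕ.≤ 1 → x ∈ X → y ∈ X → x ≡ y
∈-length≤1 {X = _ ∷ []} _ (here refl) (here refl) = refl
∈-length≤1 {X = _ ∷ _ ∷ _} (s≤s ()) _ _

independent⇒slots-distinct : ∀ I → let open Instance I in
  ∀ S {x y} → Independent S → x ∈ S → y ∈ S → proj₂ x ≡ proj₂ y → x ≡ y
independent⇒slots-distinct I S {x} S-independent x∈S y∈S x≡y = ∈-length≤1 (S-independent (proj₂ x))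
    (∈-deduplicate⁺ _≟Ω_ (∈-filter⁺ (λ e → proj₂ e ℕ.≟ proj₂ x) x∈S refl))
    (∈-deduplicate⁺ _≟Ω_ (∈-filter⁺ (λ e → proj₂ e ℕ.≟ proj₂ x) y∈S (sym x≡y)))
  where open Instance I

-- Permute `x` to the front of `ys` and cut it off there. As `xs` has no repetitions, its tail still
-- lies in the rest.
sum-map-⊆ : ∀ (w : ℕ → ℕ) {xs ys} → Unique xs → xs ⊆ ys → sum (map w xs) ℕ.≤ sum (map w ys)
sum-map-⊆ w []                            xs⊆ys = z≤n
sum-map-⊆ w {x ∷ xs} (x∉xs ∷ xs-unique) xs⊆ys with ∈-∃++ (xs⊆ys (here refl))
... | as , bs , refl = subst (w x ℕ.+ sum (map w xs) ℕ.≤_) (sym (sum-↭ (map⁺ w (shift x as bs))))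
    (ℕ.+-monoʳ-≤ (w x) (sum-map-⊆ w xs-unique xs⊆rest))
  where
  xs⊆rest : xs ⊆ as ++ bs
  xs⊆rest y∈xs with ∈-resp-↭ (shift x as bs) (xs⊆ys (there y∈xs))
  ... | here y≡x = ⊥-elim (All.lookup x∉xs y∈xs (sym y≡x))
  ... | there y∈ = y∈

-- Instances with natural number weights

module Weighted (w : ℕ → ℕ) where

  weighted : Instance
  weighted = record
    { U   = ℕ
    ; _≟_ = ℕ._≟_
    ; ν   = λ u → fromℚ (fromℕ (w u))
    ; ν≥0 = λ { u (δ , 0<δ , N , below) →
                ℚ.<-irrefl refl (ℚ.<-≤-trans
                  (ℚ.≤-<-trans (0≤fromℕ (w u)) (p<p+q (fromℕ (w u)) 0<δ)) (below N ℕ.≤-refl)) }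
    }

  open Instance weighted using (f; select)

  value : List ℕ → ℕ
  value X = sum (map w (deduplicate ℕ._≟_ X))

  value-mono : ∀ {X Y} → X ⊆ Y → value X ℕ.≤ value Y
  value-mono {X} {Y} X⊆Y = sum-map-⊆ w (deduplicate-! X)
    (∈-deduplicate⁺ ℕ._≟_ ∘ X⊆Y ∘ ∈-deduplicate⁻ ℕ._≟_ X)

  value-unique : ∀ {X} → Unique X → value X ≡ sum (map w X)
  value-unique {X} X-unique = ℕ.≤-antisym
    (sum-map-⊆ w (deduplicate-! X) (∈-deduplicate⁻ ℕ._≟_ X))
    (sum-map-⊆ w X-unique (∈-deduplicate⁺ ℕ._≟_))

  -- Each `f S` is a constant sequence, so comparisons of real values reduce to comparisons in ℕ.
  seq-f : ∀ S n → seq (f S) n ≡ fromℕ (value (map proj₁ S))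
  seq-f S n = sum-seq (deduplicate ℕ._≟_ (map proj₁ S))
    where
    sum-seq : ∀ X → seq (foldr _+_ 0ℝ (map (λ u → fromℚ (fromℕ (w u))) X)) n ≡ fromℕ (sum (map w X))
    sum-seq []      = refl
    sum-seq (u ∷ X) = trans (cong (fromℕ (w u) ℚ.+_) (sum-seq X)) (sym (×-homo-+ 1ℚ (w u) (sum (map w X))))

  f-≤ : ∀ S T → value (map proj₁ S) ℕ.≤ value (map proj₁ T) → f S ≤ f T
  f-≤ S T S≤T (δ , 0<δ , N , T+δ≤S) = ℚ.<-irrefl refl (ℚ.<-≤-trans
    (ℚ.≤-<-trans (fromℕ-mono-≤ S≤T) (p<p+q (fromℕ (value (map proj₁ T))) 0<δ))
    (subst₂ (λ x y → x ℚ.+ δ ℚ.≤ y) (seq-f T N) (seq-f S N) (T+δ≤S N ℕ.≤-refl)))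

  -- Since `_≤_` is a negated `_<_`, it suffices to witness `f S < r * f T`; the constant gap ρ t -
  -- s works on the tail where `r` is at least `ρ`.
  ratio-violated : ∀ {ρ r} → EventuallyAtLeast ρ r → ∀ S T →
    fromℕ (value (map proj₁ S)) ℚ.< ρ ℚ.* fromℕ (value (map proj₁ T)) → ¬ (r * f T ≤ f S)
  ratio-violated {ρ} {r} (N , ρ≤r) S T S<ρT rT≤S =
    rT≤S (ρ ℚ.* t ℚ.- s , gap , N , λ n N≤n → begin
      seq (f S) n ℚ.+ (ρ ℚ.* t ℚ.- s) ≡⟨ cong (ℚ._+ (ρ ℚ.* t ℚ.- s)) (seq-f S n) ⟩
      s ℚ.+ (ρ ℚ.* t ℚ.- s)           ≡⟨ cancel s (ρ ℚ.* t) ⟩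
      ρ ℚ.* t                         ≤⟨ ℚ.*-monoʳ-≤-nonNeg t (ρ≤r n N≤n) ⟩
      seq r n ℚ.* t                   ≡⟨ cong (seq r n ℚ.*_) (seq-f T n) ⟨
      seq r n ℚ.* seq (f T) n         ∎)
    where
    s = fromℕ (value (map proj₁ S))
    t = fromℕ (value (map proj₁ T))
    instance
      t-nonNeg : ℚ.NonNegative t
      t-nonNeg = ℚ.nonNegative (0≤fromℕ (value (map proj₁ T)))
    open ℚ.≤-Reasoning
    open ℚ.+-*-Solver
    cancel : ∀ x y → x ℚ.+ (y ℚ.- x) ≡ y
    cancel = solve 2 (λ x y → x :+ (y :- x) := y) refl
    gap : 0ℚ ℚ.< ρ ℚ.* t ℚ.- s
    gap = subst (ℚ._< ρ ℚ.* t ℚ.- s) (ℚ.+-inverseʳ s) (ℚ.+-monoˡ-< (ℚ.- s) S<ρT)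

  select-∅ : ∀ σ → select σ ∅ ≡ []
  select-∅ []      = refl
  select-∅ (_ ∷ σ) = select-∅ σ

-- The arrival sequence and its optima

-- Latest arrival first, as in `run`. All items compete for slot 0, while slot `suc j` only ever
-- receives the copy of item `j`.
arrivals : ℕ → List (ℕ × ℕ)
arrivals zero    = []
arrivals (suc j) = (j , suc j) ∷ (j , 0) ∷ arrivals j

arrivals-< : ∀ j → All (λ e → proj₁ e ℕ.< j) (arrivals j)
arrivals-< zero    = []
arrivals-< (suc j) = ℕ.n<1+n j ∷ ℕ.n<1+n j ∷ All.map ℕ.m<n⇒m<1+n (arrivals-< j)

arrivals⁺-< : ∀ j → All (λ e → proj₁ e ℕ.< suc j) ((j , 0) ∷ arrivals j)
arrivals⁺-< j = All.tail (arrivals-< (suc j))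

∉-arrivals : ∀ j i → All ((j , i) ≢_) (arrivals j)
∉-arrivals j i = All.map (λ { e<j refl → ℕ.<-irrefl refl e<j }) (arrivals-< j)

arrivals-unique  : ∀ j → Unique (arrivals j)
arrivals⁺-unique : ∀ j → Unique ((j , 0) ∷ arrivals j)

arrivals-unique zero    = []
arrivals-unique (suc j) = ((λ ()) ∷ ∉-arrivals j (suc j)) ∷ arrivals⁺-unique j
arrivals⁺-unique j = ∉-arrivals j 0 ∷ arrivals-unique j

diagonal : ℕ → List (ℕ × ℕ)
diagonal j = map (λ i → i , suc i) (downFrom j)

optimum : ℕ → List (ℕ × ℕ)
optimum j = (j , 0) ∷ diagonal j

diagonal-⊆ : ∀ j → diagonal j ⊆ arrivals j
diagonal-⊆ (suc j) (here refl) = here refl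
diagonal-⊆ (suc j) (there e∈)  = there (there (diagonal-⊆ j e∈))

optimum-⊆ : ∀ j → optimum j ⊆ (j , 0) ∷ arrivals j
optimum-⊆ j (here refl) = here refl
optimum-⊆ j (there e∈)  = there (diagonal-⊆ j e∈)

optimum-items : ∀ j → map proj₁ (optimum j) ≡ downFrom (suc j)
optimum-items j = cong (j ∷_) (trans (sym (map-∘ (downFrom j))) (map-id (downFrom j)))

optimum-slots : ∀ j → Unique (map proj₂ (optimum j))
optimum-slots j = subst (λ X → Unique (0 ∷ X)) (map-∘ (downFrom j))
  (All.map⁺ (All.tabulate λ _ ()) ∷ Unique.map⁺ ℕ.suc-injective (downFrom⁺ j))

⊆-∅ : ∀ {n} {S : Subset n} → S ⊆ˢ ∅ → S ≡ ∅
⊆-∅ S⊆∅ = ⊆-antisym S⊆∅ ⊥⊆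

-- The adversary against a strictly monotone algorithm

module Game (A : Algorithm) (mono : StrictlyMonotone A) {r : ℝ} (competitive : HasCompetitiveRatio A r)
            {ρ : ℚ} (ρ≤r : EventuallyAtLeast ρ r)
            (n : ℕ) (N+3<4ρ[N+1] : fromℕ (4 ℕ.+ n) ℚ.< ρ ℚ.* fromℕ (4 ℕ.* (2 ℕ.+ n))) where

  N : ℕ
  N = suc n

  open Algorithm A
  open Weighted (itemWeight N)
  open Instance weighted using (f; select; IsOPT)

  held : (σ : List (ℕ × ℕ)) → Subset (length σ)
  held = run weighted step

  items : (σ : List (ℕ × ℕ)) → Subset (length σ) → List ℕ
  items σ X = map proj₁ (select σ X)

  value-optimum : ∀ j → value (map proj₁ (optimum j)) ≡ total (itemWeight N) (suc j)
  value-optimum j = trans (cong value (optimum-items j)) (value-unique (downFrom⁺ (suc j)))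

  -- `optimum j` already counts every item that has arrived, so it dominates any set of arrivals.
  -- Leaving `σ` general covers the moments before and after the copy `(j , suc j)` arrives.
  isOPT : ∀ j {σ} → optimum j ⊆ σ → All (λ e → proj₁ e ℕ.< suc j) σ → IsOPT σ (optimum j)
  isOPT j ⊆σ σ< = ⊆σ , slots-distinct⇒independent weighted (optimum j) (optimum-slots j) ,
    λ T T⊆σ _ → f-≤ T (optimum j) (value-mono λ {u} u∈T →
      subst (u ∈_) (sym (optimum-items j))
        (case ∈-map⁻ proj₁ u∈T of λ { (e , e∈T , refl) → ∈-downFrom⁺ (All.lookup σ< (T⊆σ e∈T)) }))

  -- The bound puts the ratio achieved at or below (N + 3) / (4 (N + 1)), hence below `ρ`. The
  -- variable `X` lets callers insert the pattern found by case analysis.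
  stop : ∀ j p → j ℕ.+ p ≡ N → ∀ {σ} → Unique σ → optimum j ⊆ σ → All (λ e → proj₁ e ℕ.< suc j) σ →
         ∀ {X} → held σ ≡ X →
         ¬ (4 ℕ.* suc N ℕ.* value (items σ X) ℕ.≤ (3 ℕ.+ N) ℕ.* total (itemWeight N) (suc j))
  stop j p j+p≡N {σ} σ-unique ⊆σ σ< refl bound with total-suc j p
  ... | b , total≡ = ratio-violated {r = r} ρ≤r (solution weighted step σ) (optimum j)
    (subst (λ t → fromℕ (value (items σ (held σ))) ℚ.< ρ ℚ.* fromℕ t) (sym optimum≡)
      (scaled-< ρ (4 ℕ.* suc N) (3 ℕ.+ N) N+3<4ρ[N+1] {a = value (items σ (held σ))}
        (subst (λ t → 4 ℕ.* suc N ℕ.* value (items σ (held σ)) ℕ.≤ (3 ℕ.+ N) ℕ.* t) total≡′ bound)))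
    (competitive weighted σ σ-unique (optimum j) (isOPT j ⊆σ σ<))
    where
    total≡′ : total (itemWeight N) (suc j) ≡ suc b
    total≡′ = trans (cong (λ M → total (itemWeight M) (suc j)) (sym j+p≡N)) total≡
    optimum≡ : value (map proj₁ (optimum j)) ≡ suc b
    optimum≡ = trans (value-optimum j) total≡′

  nothing-held : ∀ j p → j ℕ.+ p ≡ N → ∀ {σ} → Unique σ → optimum j ⊆ σ → All (λ e → proj₁ e ℕ.< suc j) σ →
                 ∀ {X} → held σ ≡ X → ¬ (select σ X ≡ [])
  nothing-held j p j+p≡N {σ} σ-unique ⊆σ σ< {X} held≡ empty = stop j p j+p≡N σ-unique ⊆σ σ< held≡
    (subst (ℕ._≤ (3 ℕ.+ N) ℕ.* total (itemWeight N) (suc j))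
      (sym (trans (cong (λ S → 4 ℕ.* suc N ℕ.* value (map proj₁ S)) empty) (ℕ.*-zeroʳ (4 ℕ.* suc N)))) z≤n)

  one-held : ∀ j σ → value (j ∷ map proj₁ (select σ ∅)) ≡ itemWeight N j
  one-held j σ = trans (cong (λ S → value (j ∷ map proj₁ S)) (select-∅ σ)) (ℕ.+-identityʳ _)

  -- Dropping item `j` without taking the copy leaves nothing; taking the copy adds no new item, so
  -- strict monotonicity forbids it.
  skip-copy : ∀ j p → j ℕ.+ p ≡ N → held ((j , 0) ∷ arrivals j) ≡ inside ∷ ∅ →
              held (arrivals (suc j)) ≡ outside ∷ inside ∷ ∅
  skip-copy j p j+p≡N before = cases (held σ) refl
      (subst (λ X → held σ ⊆ˢ inside ∷ X) before
        (noRetrieval weighted (j , suc j) σ⁻ (arrivals-unique (suc j))))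
    where
    σ  = arrivals (suc j)
    σ⁻ = (j , 0) ∷ arrivals j
    cases : ∀ X → held σ ≡ X → X ⊆ˢ inside ∷ inside ∷ ∅ → held σ ≡ outside ∷ inside ∷ ∅
    cases (outside ∷ inside ∷ X) eq X⊆ =
      trans eq (cong (λ X → outside ∷ inside ∷ X) (⊆-∅ (drop-∷-⊆ (drop-∷-⊆ X⊆))))
    cases (outside ∷ outside ∷ X) eq X⊆ = ⊥-elim
      (nothing-held j p j+p≡N (arrivals-unique (suc j)) (there ∘ optimum-⊆ j) (arrivals-< (suc j)) eq
        (trans (cong (select (arrivals j)) (⊆-∅ (drop-∷-⊆ (drop-∷-⊆ X⊆)))) (select-∅ (arrivals j))))
    -- Whether `(j , 0)` is kept or exchanged for the copy, item `j` is the only item counted.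
    cases (inside ∷ b ∷ X) eq X⊆ = ⊥-elim
      (f-≤ (solution weighted step σ) (solution weighted step σ⁻)
        (subst₂ (λ Y Z → value (items σ Y) ℕ.≤ value (items σ⁻ Z)) (sym eq) (sym before)
          (value-mono (covered b X (⊆-∅ (drop-∷-⊆ (drop-∷-⊆ X⊆))))))
        (mono weighted (j , suc j) σ⁻ (arrivals-unique (suc j)) (cong head eq)))
      where
      covered : ∀ b X → X ≡ ∅ → items σ (inside ∷ b ∷ X) ⊆ items σ⁻ (inside ∷ ∅)
      covered inside  _ refl (here refl)         = here refl
      covered inside  _ refl (there (here refl)) = here refl
      covered inside  _ refl (there (there u∈))  = there u∈
      covered outside _ refl u∈                  = u∈

  -- Every response other than exchanging item `j` for item `suc j` breaks a rule or loses at an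
  -- immediate stop.
  replace-item : ∀ j p → j ℕ.+ suc p ≡ N → held (arrivals (suc j)) ≡ outside ∷ inside ∷ ∅ →
                 held ((suc j , 0) ∷ arrivals (suc j)) ≡ inside ∷ ∅
  replace-item j p j+p≡N before = cases (held σ) refl
      (subst (λ X → held σ ⊆ˢ inside ∷ X) before
        (noRetrieval weighted (suc j , 0) (arrivals (suc j)) (arrivals⁺-unique (suc j))))
    where
    σ = (suc j , 0) ∷ arrivals (suc j)
    j+p≡N′ : suc j ℕ.+ p ≡ N
    j+p≡N′ = trans (sym (ℕ.+-suc j p)) j+p≡N
    cases : ∀ X → held σ ≡ X → X ⊆ˢ inside ∷ outside ∷ inside ∷ ∅ → held σ ≡ inside ∷ ∅
    -- This would retrieve the rejected copy of item `j`.
    cases (b ∷ inside ∷ X) eq X⊆ = case drop-∷-⊆ X⊆ here of λ ()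
    cases (inside ∷ outside ∷ outside ∷ X) eq X⊆ =
      trans eq (cong (λ X → inside ∷ outside ∷ outside ∷ X) (⊆-∅ (drop-∷-⊆ (drop-∷-⊆ (drop-∷-⊆ X⊆)))))
    -- Two different items would share slot 0.
    cases (inside ∷ outside ∷ inside ∷ X) eq X⊆
      with refl ← ⊆-∅ (drop-∷-⊆ (drop-∷-⊆ (drop-∷-⊆ X⊆)))
      = case independent⇒slots-distinct weighted (select σ (inside ∷ outside ∷ inside ∷ ∅))
          (subst (λ Y → Instance.Independent weighted (select σ Y)) eq
            (keepsIndependent weighted σ (arrivals⁺-unique (suc j))))
          (here refl) (there (here refl)) refl of λ ()
    cases (outside ∷ outside ∷ outside ∷ X) eq X⊆ = ⊥-elim
      (nothing-held (suc j) p j+p≡N′ (arrivals⁺-unique (suc j)) (optimum-⊆ (suc j)) (arrivals⁺-< (suc j)) eq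
        (trans (cong (select (arrivals j)) (⊆-∅ (drop-∷-⊆ (drop-∷-⊆ (drop-∷-⊆ X⊆))))) (select-∅ (arrivals j))))
    -- Item `j` is kept and the new item refused: the stop governed by `reject-bound`.
    cases (outside ∷ outside ∷ inside ∷ X) eq X⊆
      with refl ← ⊆-∅ (drop-∷-⊆ (drop-∷-⊆ (drop-∷-⊆ X⊆)))
      = ⊥-elim (stop (suc j) p j+p≡N′ (arrivals⁺-unique (suc j)) (optimum-⊆ (suc j)) (arrivals⁺-< (suc j)) eq
          (subst (λ a → 4 ℕ.* suc N ℕ.* a ℕ.≤ (3 ℕ.+ N) ℕ.* total (itemWeight N) (2 ℕ.+ j))
            (sym (one-held j (arrivals j)))
            (subst (λ M → 4 ℕ.* suc M ℕ.* itemWeight M j ℕ.≤ (3 ℕ.+ M) ℕ.* total (itemWeight M) (2 ℕ.+ j))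
              j+p≡N (reject-bound j p))))

  first-item : held ((0 , 0) ∷ []) ≡ inside ∷ ∅
  first-item = cases (held ((0 , 0) ∷ [])) refl
    where
    cases : ∀ X → held ((0 , 0) ∷ []) ≡ X → held ((0 , 0) ∷ []) ≡ inside ∷ ∅
    cases (inside  ∷ []) eq = eq
    cases (outside ∷ []) eq = ⊥-elim
      (nothing-held 0 N refl (arrivals⁺-unique 0) (optimum-⊆ 0) (arrivals⁺-< 0) eq refl)

  -- Induction on the number `p` of items still to come; each round forces an exchange, until item
  -- `N` is held and `final-bound` applies.
  play : ∀ j p → j ℕ.+ p ≡ N → ¬ (held ((j , 0) ∷ arrivals j) ≡ inside ∷ ∅)
  play j (suc p) j+p≡N holds-j = play (suc j) p (trans (sym (ℕ.+-suc j p)) j+p≡N)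
    (replace-item j p j+p≡N (skip-copy j (suc p) j+p≡N holds-j))
  play j zero j+0≡N holds-j with refl ← trans (sym (ℕ.+-identityʳ j)) j+0≡N =
    stop N 0 j+0≡N (arrivals⁺-unique N) (optimum-⊆ N) (arrivals⁺-< N) holds-j
      (subst (λ a → 4 ℕ.* suc N ℕ.* a ℕ.≤ (3 ℕ.+ N) ℕ.* total (itemWeight N) (suc N))
        (sym (one-held N (arrivals N))) (final-bound n))

  absurd : ⊥
  absurd = play 0 N refl first-item

theorem6p1 : ∀ (α : ℝ) (0<α : 0ℝ < α) → α < 4ℝ →
    (A : Algorithm) → StrictlyMonotone A →
    ∀ (r : ℝ) → recip α 0<α < r → ¬ HasCompetitiveRatio A r
theorem6p1 α 0<α α<4 A mono r 1/α<r competitive =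
  -- The margin of `r` above 1/4 fixes the horizon and with it the weights; the algorithm's
  -- responses determine only where the sequence stops.
  let δ , 0<δ , ¼+δ≤r = above-recip α 0<α α<4 r 1/α<r
      n , large       = horizon δ 0<δ
  in Game.absurd A mono {r} competitive ¼+δ≤r n large
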